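{- Let $\mathcal I,\mathcal J$ be ideals on $\omega$ and let $\mathcal F,\mathcal G\subseteq\omega^\omega$. If $\mathcal G$ contains the identity function, then $\mathfrak u(\mathcal I,\mathcal F,\mathcal J,\mathcal G)>|\mathcal F|$ if and only if there exists an ultrafilter $\mathcal U$ on $\omega$ such that $\mathcal I\not\le_{\mathcal F}\mathcal U^*$ and $\mathcal J\le_{\mathcal G}\mathcal U^*$.
   Context: An ideal on $\omega$ is a family of subsets of $\omega$ closed under finite unions and subsets, containing all finite sets and not containing $\omega$. Ultrafilters on $\omega$ contain all cofinite sets; $\mathcal U^*=\{\omega\setminus A:A\in\mathcal U\}$ is the dual ideal. For $\mathcal F\subseteq\omega^\omega$ and ideals $\mathcal I,\mathcal K$ on $\omega$, $\mathcal I\le_{\mathcal F}\mathcal K$ means that there is $f\in\mathcal F$ with $f^{ -1}[B]\in\mathcal K$ for every $B\in\mathcal I$. For an ideal $\mathcal K$ on $\omega$ and $\mathcal A\subseteq\mathcal P(\omega)$ let $\mathcal K(\mathcal A)=\{B\subseteq\omega:\exists F\in[\mathcal A]^{<\omega}\ (B\setminus\bigcup F\in\mathcal K)\}$; it is an ideal exactly when $\omega\notin\mathcal K(\mathcal A)$. For a cardinal $\lambda\le\mathfrak c=2^{\aleph_0}$, $\mathcal I\preceq^\lambda_{\mathcal F,\mathcal G}\mathcal J$ means: for each ideal $\mathcal J'$ on $\omega$ with $\mathcal J\le_{\mathcal G}\mathcal J'$ there exists $\mathcal A\subseteq\mathcal P(\omega)$ with $|\mathcal A|<\lambda$ such that $\omega\notin\mathcal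 J'(\mathcal A)$ and $\mathcal I\le_{\mathcal F}\mathcal J'(\mathcal A)$. Finally $$\mathfrak u(\mathcal I,\mathcal F,\mathcal J,\mathcal G)=\min\left(\{\lambda\le\mathfrak c:\mathcal I\preceq^\lambda_{\mathcal F,\mathcal G}\mathcal J\}\cup\{\mathfrak c^+\}\right).$$ -}

module Defs where

open import Axiom.ExcludedMiddle using (ExcludedMiddle)
open import Data.Bool.Base using (Bool)
open import Data.Empty using (⊥)
open import Data.List.Base using (List; foldr)
open import Data.List.Membership.Propositional using () renaming (_∈_ to _∈ₗ_)
open import Data.List.Relation.Unary.All using (All)
open import Data.Nat.Base using (ℕ)
open import Data.Product.Base using (Σ; ∃; ∃-syntax; _×_; _,_; proj₁)
open import Data.Sum.Base using (_⊎_)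
open import Function.Bundles using (Injection; Bijection)
open import Level using (Level; 0ℓ; suc; _⊔_)
open import Relation.Binary.Bundles using (Setoid)
import Relation.Binary.Construct.On as On
open import Relation.Binary.PropositionalEquality using (_≡_; setoid; _→-setoid_)
open import Relation.Nullary.Decidable.Core using (yes; no)
open import Relation.Nullary.Negation.Core using (¬_)
open import Relation.Unary using (Pred; _∈_; _∉_; _⊆_; _≐_; _∪_; _∩_; _∖_; _⊢_; ∁; ∅; U; Satisfiable)
open import Relation.Unary.Relation.Binary.Equality using (≐-setoid)

private
  variable
    a b ℓ ℓ₁ ℓ₂ : Level

1ℓ : Level
1ℓ = suc 0ℓ

-- The mathematics takes place in ZFC.  Excluded middle (at every level) and
-- the axiom of choice below are therefore explicit arguments wherever they
-- are used.

-- Every X has a choice function on its nonempty subsets.  The last conjunct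
-- makes it a function of the subset itself: it depends neither on the proof of
-- nonemptiness nor on the predicate presenting the subset.  Without it the
-- principle would carry no content in type theory.
AxiomOfChoice : ∀ a p → Set (suc (a ⊔ p))
AxiomOfChoice a p =
  (X : Set a) →
  Σ ((P : Pred X p) → Satisfiable P → X) λ c →
    (∀ P (s : Satisfiable P) → c P s ∈ P) ×
    (∀ P Q (s : Satisfiable P) (t : Satisfiable Q) → P ≐ Q → c P s ≡ c Q t)

-- Subsets of ω are compared by _≐_ and functions ω → ω pointwise.  A predicate
-- on either need not respect this equality; it then stands for the set of all
-- objects equal to one satisfying it.

Subset : Set₁
Subset = Pred ℕ 0ℓ

Family : Set₂
Family = Pred Subset 1ℓ

Functions : Set₁
Functions = Pred (ℕ → ℕ) 0ℓ

Finite : Pred Subset 0ℓ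
Finite B = ∃[ xs ] (∀ {n} → n ∈ B → n ∈ₗ xs)

record IsIdeal (I : Family) : Set₁ where
  field
    ∪-closed : ∀ {A B} → A ∈ I → B ∈ I → (A ∪ B) ∈ I
    ⊆-closed : ∀ {A B} → A ⊆ B → B ∈ I → A ∈ I
    finite∈ : ∀ {A} → A ∈ Finite → A ∈ I
    ω∉ : U ∉ I

record IsUltrafilter (𝒰 : Family) : Set₁ where
  field
    ∩-closed : ∀ {A B} → A ∈ 𝒰 → B ∈ 𝒰 → (A ∩ B) ∈ 𝒰
    ⊇-closed : ∀ {A B} → A ⊆ B → A ∈ 𝒰 → B ∈ 𝒰
    cofinite∈ : ∀ {A} → ∁ A ∈ Finite → A ∈ 𝒰
    ∅∉ : ∅ ∉ 𝒰
    ultra : ∀ A → A ∈ 𝒰 ⊎ ∁ A ∈ 𝒰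

infix 10 _*

_* : Family → Family
(𝒰 *) B = ∃[ A ] A ∈ 𝒰 × B ≐ ∁ A

infix 4 _≤[_]_

_≤[_]_ : Family → Functions → Family → Set₁
I ≤[ F ] K = ∃[ f ] f ∈ F × (∀ B → B ∈ I → (f ⊢ B) ∈ K)

⋃ₗ : List Subset → Subset
⋃ₗ = foldr _∪_ ∅

infix 10 _⟨_⟩

_⟨_⟩ : Family → Family → Family
(K ⟨ 𝒜 ⟩) B = ∃[ Fs ] All (_∈ 𝒜) Fs × (B ∖ ⋃ₗ Fs) ∈ K

-- A cardinal is represented by any setoid of that cardinality.

Cardinal : Set₁
Cardinal = Setoid 0ℓ 0ℓ

infix 4 _≤ᶜ_ _<ᶜ_ _≈ᶜ_

_≤ᶜ_ : Setoid a ℓ₁ → Setoid b ℓ₂ → Set _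
κ ≤ᶜ μ = Injection κ μ

_<ᶜ_ : Setoid a ℓ₁ → Setoid b ℓ₂ → Set _
κ <ᶜ μ = κ ≤ᶜ μ × ¬ (μ ≤ᶜ κ)

_≈ᶜ_ : Setoid a ℓ₁ → Setoid b ℓ₂ → Set _
κ ≈ᶜ μ = Bijection κ μ

card : Functions → Cardinal
card F = On.setoid {B = ∃ F} (ℕ →-setoid ℕ) proj₁

cardFamily : Family → Setoid 1ℓ 0ℓ
cardFamily 𝒜 = On.setoid {B = ∃ 𝒜} (≐-setoid ℕ 0ℓ) proj₁

𝔠 : Cardinal
𝔠 = ℕ →-setoid Bool

IsLeast : Pred Cardinal ℓ → Pred Cardinal (1ℓ ⊔ ℓ)
IsLeast C κ = κ ∈ C × (∀ μ → μ ∈ C → κ ≤ᶜ μ)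

-- Cardinals are well-ordered in ZFC, so the default value 0 is taken only
-- when C is empty.
min : (∀ {ℓ} → ExcludedMiddle ℓ) → Pred Cardinal ℓ → Cardinal
min em C with em {P = ∃ (IsLeast C)}
... | yes (κ , _) = κ
... | no  _       = setoid ⊥

𝔠⁺ : (∀ {ℓ} → ExcludedMiddle ℓ) → Cardinal
𝔠⁺ em = min em (𝔠 <ᶜ_)

infix 4 _≼[_,_,_]_

_≼[_,_,_]_ : Family → Cardinal → Functions → Functions → Family → Set₂
I ≼[ κ , F , G ] J =
  ∀ J′ → IsIdeal J′ → J ≤[ G ] J′ →
  ∃[ 𝒜 ] cardFamily 𝒜 <ᶜ κ × U ∉ J′ ⟨ 𝒜 ⟩ × I ≤[ F ] J′ ⟨ 𝒜 ⟩

𝔲 : (∀ {ℓ} → ExcludedMiddle ℓ) → Family → Functions → Family → Functions → Cardinal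
𝔲 em I F J G =
  min em λ κ → (κ ≤ᶜ 𝔠 × I ≼[ κ , F , G ] J) ⊎ κ ≈ᶜ 𝔠⁺ em

{-# OPTIONS --safe #-}
module Submission where

-- Suppose that |F| < 𝔲.  Since |F| ≤ 𝔠, minimality of 𝔲 says that
-- I ≼[ |F| , F , G ] J fails: there is an ideal J′ with J ≤[ G ] J′ such that
-- fewer than |F| sets added to J′ never yield an ideal above I for ≤[ F ].
-- Well-order F in its initial order type and go through it by transfinite recursion.  When
-- f is reached, the sets 𝒜 added so far are fewer than |F|, so f does not
-- witness I ≤[ F ] J′ ⟨ 𝒜 ⟩ and some B in I has f ⊢ B outside of J′ ⟨ 𝒜 ⟩.
-- Adding the complement of f ⊢ B keeps the ideal proper (∉⇒∁-adjoinable) and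
-- defeats f for good.  Only finitely many added sets are involved in any
-- member of the ideal, so limit stages are harmless (greedy-extension) and the
-- final ideal is proper.  Any ultrafilter whose dual ideal contains it is as
-- required (defeating-ultrafilter).
--
-- Conversely, let 𝒰 be an ultrafilter as on the right.  Its dual ideal is
-- maximal, so adding sets to it properly does not change it (*-maximal).
-- Hence it refutes I ≼[ κ , F , G ] J for every κ at once, which leaves
-- 𝔲 = 𝔠⁺ > 𝔠 ≥ |F|.
--
-- Both directions need the minimum defining 𝔲 to be attained, that is, any
-- nonempty class of cardinals to have a least element (least-cardinal), and
-- the first one also needs initial well-orders (initial-rank).  Both come from
-- a type Ord of ordinals one universe above the cardinals.  By the
-- Burali-Forti argument Ord injects into no cardinal, so a transfinite
-- enumeration of a cardinal X by fresh elements exhausts X before Ord ends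
-- (compare, embeds-Below), which ranks X by ordinals.

open import Defs
open import Axiom.ExcludedMiddle using (ExcludedMiddle)
open import Axiom.DoubleNegationElimination using (em⇒dne)
open import Data.Bool.Base using (Bool; true; false)
open import Data.Empty using (⊥; ⊥-elim)
open import Data.List.Base using (List; []; _∷_; _++_)
open import Data.List.Relation.Unary.All as All using (All; []; _∷_)
open import Data.List.Relation.Unary.All.Properties using (++⁺)
open import Data.Nat.Base using (ℕ; zero; suc)
open import Data.Product.Base using (Σ; Σ-syntax; ∃; ∃-syntax; _×_; _,_; proj₁; proj₂)
open import Data.Sum.Base using (_⊎_; inj₁; inj₂; [_,_]′)
open import Data.Unit.Base using (tt)
open import Function.Base using (id; _∘_; _on_)
open import Function.Bundles using (_⇔_; Injection; mk⇔)
import Function.Construct.Composition as Composition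
import Function.Construct.Identity as Identity
open import Function.Properties.Bijection using (Bijection⇒Inverse)
open import Function.Properties.Inverse using (Inverse⇒Injection)
import Function.Properties.Inverse as Inverse
open import Induction.WellFounded as WF using (Acc; acc; WellFounded)
open import Level using (Level; 0ℓ; _⊔_)
open import Relation.Binary.Bundles using (Setoid)
open import Relation.Binary.Core using (Rel)
import Relation.Binary.Construct.On as On
open import Relation.Binary.PropositionalEquality using (_≡_; refl; sym; trans; cong; subst; _≗_; _→-setoid_)
open import Relation.Nullary.Decidable.Core using (yes; no; does)
open import Relation.Nullary.Decidable using (dec-true; does-⇔)
open import Relation.Nullary.Negation.Core using (¬_; contradiction)
open import Relation.Unary using (Pred; _∈_; _∉_; _⊆_; _≐_; _∪_; _∩_; _⊢_; ∁; ∅; U; ｛_｝; Satisfiable)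
open Setoid using (Carrier)

private
  variable
    a b d p q t ℓ : Level

-- Ordinals

-- The ordinal sup⁺ f is the least one above all f a.  The index types are
-- small and Ord is not, so Ord is closed under suprema of small families.
data Ord : Set₁ where
  sup⁺ : {A : Set} → (A → Ord) → Ord

infix 4 _≤_ _<_

_≤_ : Ord → Ord → Set
sup⁺ f ≤ sup⁺ g = ∀ i → ∃[ j ] f i ≤ g j

_<_ : Ord → Ord → Set
α < sup⁺ g = ∃[ j ] α ≤ g j

≤-refl : ∀ {α} → α ≤ α
≤-refl {sup⁺ f} i = i , ≤-refl

≤-trans : ∀ {α β γ} → α ≤ β → β ≤ γ → α ≤ γ
≤-trans {sup⁺ _} {sup⁺ _} {sup⁺ _} p q i =
  let (j , r) = p i ; (k , s) = q j in k , ≤-trans r s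

<-≤-trans : ∀ {α β γ} → α < β → β ≤ γ → α < γ
<-≤-trans {_} {sup⁺ _} {sup⁺ _} (j , r) q = let (k , s) = q j in k , ≤-trans r s

<-wellFounded : WellFounded _<_
<-wellFounded α = below α ≤-refl
  where
  below : ∀ α {β} → β ≤ α → Acc _<_ β
  below (sup⁺ f) β≤ = acc λ γ<β → let (i , r) = <-≤-trans γ<β β≤ in below (f i) r

<-irrefl : ∀ {α} → ¬ (α < α)
<-irrefl α<α = WF.wf⇒asym <-wellFounded α<α α<α

<⇒≤ : ∀ {α β} → α < β → α ≤ β
<⇒≤ {sup⁺ f} {sup⁺ g} (j , r) i = j , <⇒≤ {f i} (<-≤-trans (i , ≤-refl) r)

Ords : Setoid _ _
Ords = record
  { Carrier = Ord
  ; _≈_ = λ α β → α ≤ β × β ≤ α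
  ; isEquivalence = record
    { refl = ≤-refl , ≤-refl
    ; sym = λ (p , q) → q , p
    ; trans = λ (p , q) (r , s) → ≤-trans p r , ≤-trans s q
    }
  }

-- Ranked setoids and their initial segments

≤ᶜ-refl : {X : Setoid a ℓ} → X ≤ᶜ X
≤ᶜ-refl {X = X} = Identity.injection X

infixr 9 _⨾_

_⨾_ : {X : Setoid a p} {Y : Setoid b q} {Z : Setoid d ℓ} → X ≤ᶜ Y → Y ≤ᶜ Z → X ≤ᶜ Z
_⨾_ = Composition.injection

Subsetoid : (X : Setoid a ℓ) → Pred (Carrier X) p → Setoid (a ⊔ p) ℓ
Subsetoid X P = On.setoid {B = ∃ P} X proj₁

Subsetoid-⊆ : (X : Setoid a ℓ) (P : Pred (Carrier X) p) → Subsetoid X P ≤ᶜ X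
Subsetoid-⊆ X P = record { to = proj₁ ; cong = id ; injective = id }

-- An injection into the ordinals is the same as a well-order: the elements
-- are compared by their ranks.
module Ranked {D : Setoid d ℓ} (rank : D ≤ᶜ Ords) where
  open Injection rank public using () renaming (to to rk; cong to rk-cong; injective to rk-injective)

  infix 4 _◁_ _⊴_

  _◁_ _⊴_ : Rel (Carrier D) 0ℓ
  _◁_ = _<_ on rk
  _⊴_ = _≤_ on rk

  ◁-wellFounded : WellFounded _◁_
  ◁-wellFounded = On.wellFounded rk <-wellFounded

  Segment : Carrier D → Setoid d ℓ
  Segment x = Subsetoid D (_◁ x)

  Segment⊆ : ∀ x → Segment x ≤ᶜ D
  Segment⊆ x = Subsetoid-⊆ D (_◁ x)

Below : Ord → Setoid _ _
Below α = Subsetoid Ords (_< α)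

Below⊆ : ∀ α → Below α ≤ᶜ Ords
Below⊆ α = Subsetoid-⊆ Ords (_< α)

Segment≤Below : {D : Setoid d ℓ} (rank : D ≤ᶜ Ords) →
                ∀ x → Ranked.Segment rank x ≤ᶜ Below (Injection.to rank x)
Segment≤Below rank x = record
  { to = λ (y , y◁x) → rk y , y◁x ; cong = rk-cong ; injective = rk-injective }
  where open Ranked rank

image : {D : Set d} {T : Set t} → (D → T) → Pred D p → Pred T (d ⊔ t ⊔ p)
image h L y = ∃[ x ] x ∈ L × y ≡ h x

-- Families generated by an ideal

⋃ₗ-++⁺ˡ : ∀ Fs {Gs} → ⋃ₗ Fs ⊆ ⋃ₗ (Fs ++ Gs)
⋃ₗ-++⁺ˡ (F ∷ Fs) = [ inj₁ , inj₂ ∘ ⋃ₗ-++⁺ˡ Fs ]′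

⋃ₗ-++⁺ʳ : ∀ Fs {Gs} → ⋃ₗ Gs ⊆ ⋃ₗ (Fs ++ Gs)
⋃ₗ-++⁺ʳ [] = id
⋃ₗ-++⁺ʳ (F ∷ Fs) = inj₂ ∘ ⋃ₗ-++⁺ʳ Fs

⟨⟩-mono : ∀ {K 𝒜 ℬ} → 𝒜 ⊆ ℬ → K ⟨ 𝒜 ⟩ ⊆ K ⟨ ℬ ⟩
⟨⟩-mono 𝒜⊆ℬ (Fs , Fs∈ , r) = Fs , All.map 𝒜⊆ℬ Fs∈ , r

module _ {K : Family} (K-ideal : IsIdeal K) where
  open IsIdeal K-ideal

  ⊆⟨⟩ : ∀ {𝒜} → K ⊆ K ⟨ 𝒜 ⟩
  ⊆⟨⟩ B∈K = [] , [] , ⊆-closed proj₁ B∈K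

  generators∈⟨⟩ : ∀ {𝒜} → 𝒜 ⊆ K ⟨ 𝒜 ⟩
  generators∈⟨⟩ {_} {A} A∈𝒜 =
    A ∷ [] , A∈𝒜 ∷ [] , finite∈ ([] , λ (n∈A , n∉) → contradiction (inj₁ n∈A) n∉)

  ⟨⟩-isIdeal : ∀ {𝒜} → U ∉ K ⟨ 𝒜 ⟩ → IsIdeal (K ⟨ 𝒜 ⟩)
  ⟨⟩-isIdeal U∉ = record
    { ∪-closed = λ { (Fs , Fs∈ , r) (Gs , Gs∈ , s) →
        Fs ++ Gs , ++⁺ Fs∈ Gs∈ ,
        ⊆-closed
          (λ { (inj₁ n∈A , n∉) → inj₁ (n∈A , n∉ ∘ ⋃ₗ-++⁺ˡ Fs)
             ; (inj₂ n∈B , n∉) → inj₂ (n∈B , n∉ ∘ ⋃ₗ-++⁺ʳ Fs) })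
          (∪-closed r s) }
    ; ⊆-closed = λ A⊆B (Fs , Fs∈ , r) →
        Fs , Fs∈ , ⊆-closed (λ (n∈A , n∉) → A⊆B n∈A , n∉) r
    ; finite∈ = ⊆⟨⟩ ∘ finite∈
    ; ω∉ = U∉
    }

  -- A finite cover of ω modulo K by members of 𝒜 and ∁ C is a cover of C
  -- modulo K by those of its members that lie in 𝒜.
  ∉⇒∁-adjoinable : ∀ {𝒜 C} → C ∉ K ⟨ 𝒜 ⟩ → U ∉ K ⟨ 𝒜 ∪ ｛ ∁ C ｝ ⟩
  ∉⇒∁-adjoinable {𝒜} {C} C∉ (Fs , Fs∈ , r) =
    let (Gs , Gs∈ , Fs⊆) = split Fs∈ in
    C∉ (Gs , Gs∈ , ⊆-closed (λ (n∈C , n∉) → tt , λ n∈ → [ n∉ , (λ n∉C → n∉C n∈C) ]′ (Fs⊆ n∈)) r)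
    where
    split : ∀ {Fs} → All (_∈ 𝒜 ∪ ｛ ∁ C ｝) Fs →
            ∃[ Gs ] All (_∈ 𝒜) Gs × ⋃ₗ Fs ⊆ ⋃ₗ Gs ∪ ∁ C
    split [] = [] , [] , inj₁
    split (inj₁ F∈ ∷ Fs∈) = let (Gs , Gs∈ , s) = split Fs∈ in
      _ ∷ Gs , F∈ ∷ Gs∈ , [ inj₁ ∘ inj₁ , [ inj₁ ∘ inj₂ , inj₂ ]′ ∘ s ]′
    split (inj₂ refl ∷ Fs∈) = let (Gs , Gs∈ , s) = split Fs∈ in
      Gs , Gs∈ , [ inj₂ , s ]′

-- Sets of functions have size at most 𝔠

-- The sequence f is coded by the unary expansions of its values, separated by
-- false: unary m f consists of m times true, then false, then the code of f.
unary : ℕ → (ℕ → ℕ) → ℕ → Bool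
unary zero    f zero    = false
unary zero    f (suc k) = unary (f 0) (f ∘ suc) k
unary (suc m) f zero    = true
unary (suc m) f (suc k) = unary m f k

unary-cong : ∀ m {f g} → f ≗ g → unary m f ≗ unary m g
unary-cong zero f≗g zero = refl
unary-cong zero {f} {g} f≗g (suc k) rewrite f≗g 0 = unary-cong (g 0) (f≗g ∘ suc) k
unary-cong (suc m) f≗g zero = refl
unary-cong (suc m) f≗g (suc k) = unary-cong m f≗g k

unary-injective : ∀ m n {f g} → unary m f ≗ unary n g →
                  m ≡ n × unary (f 0) (f ∘ suc) ≗ unary (g 0) (g ∘ suc)
unary-injective zero zero eq = refl , eq ∘ suc
unary-injective zero (suc n) eq with () ← eq 0
unary-injective (suc m) zero eq with () ← eq 0
unary-injective (suc m) (suc n) eq =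
  let (m≡n , r) = unary-injective m n (eq ∘ suc) in cong suc m≡n , r

card≤𝔠 : ∀ F → card F ≤ᶜ 𝔠
card≤𝔠 F = record
  { to = λ (f , _) → unary 0 f
  ; cong = unary-cong 0
  ; injective = λ eq → decode (proj₂ (unary-injective 0 0 eq))
  }
  where
  decode : ∀ {f g} → unary (f 0) (f ∘ suc) ≗ unary (g 0) (g ∘ suc) → f ≗ g
  decode {f} {g} eq zero = proj₁ (unary-injective (f 0) (g 0) eq)
  decode {f} {g} eq (suc n) = decode {f ∘ suc} {g ∘ suc} (proj₂ (unary-injective (f 0) (g 0) eq)) n

module ZFC (em : ∀ {ℓ} → ExcludedMiddle ℓ) (ac : ∀ {a p} → AxiomOfChoice a p) where

  -- Comparison of cardinals

  by-contradiction : {P : Set p} → ¬ ¬ P → P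
  by-contradiction = em⇒dne em

  ≤-total : ∀ α β → α ≤ β ⊎ β < α
  ≤-total (sup⁺ f) (sup⁺ g) with em {P = ∃[ i ] ¬ (∃[ j ] f i ≤ g j)}
  ... | no ∄i = inj₁ λ i → by-contradiction λ ∄j → ∄i (i , ∄j)
  ... | yes (i , ∄j) = inj₂ (i , sup≤ (f i) λ j →
    [ (λ p → contradiction (j , p) ∄j) , id ]′ (≤-total (f i) (g j)))
    where
    sup≤ : ∀ β → (∀ j → g j < β) → sup⁺ g ≤ β
    sup≤ (sup⁺ _) g<β = g<β

  truth : Set p → Bool
  truth P = does (em {P = P})

  truth-true : {P : Set p} → P → truth P ≡ true
  truth-true = dec-true em

  true-truth : {P : Set p} → truth P ≡ true → P
  true-truth {P = P} eq with yes x ← em {P = P} = x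

  minimal : {P : Pred Ord p} → Satisfiable P → ∃[ α ] α ∈ P × (∀ {β} → β < α → β ∉ P)
  minimal {P = P} (α , α∈P) = by-contradiction λ ∄ → ∉P ∄ α α∈P
    where
    ∉P : ¬ (∃[ α ] α ∈ P × (∀ {β} → β < α → β ∉ P)) → ∀ α → α ∉ P
    ∉P ∄ = WF.All.wfRec <-wellFounded _ (_∉ P) λ β <β∉ β∈P → ∄ (β , β∈P , <β∉)

  -- The Burali-Forti paradox: if the ordinals embedded into X, the supremum
  -- of the partial inverse, a family indexed by the small set X, would lie
  -- above every ordinal, itself included.
  burali-forti : (X : Cardinal) → ¬ (Ords ≤ᶜ X)
  burali-forti X h = <-irrefl {sup⁺ inverse} (to (sup⁺ inverse) , ≤inverse _)
    where
    open Setoid X using (_≈_) renaming (refl to ≈-refl)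
    open Injection h
    inverse : Carrier X → Ord
    inverse x with em {P = ∃[ α ] to α ≈ x}
    ... | yes (α , _) = α
    ... | no _ = sup⁺ ⊥-elim
    ≤inverse : ∀ α → α ≤ inverse (to α)
    ≤inverse α with em {P = ∃[ β ] to β ≈ to α}
    ... | yes (β , e) = proj₂ (injective e)
    ... | no ∄β = contradiction (α , ≈-refl) ∄β

  -- The choice of an R-related y depends only on the set of all such y, hence
  -- only on the class of x for the equality of X.
  choose-injection : {X : Setoid a ℓ} {Y : Setoid b q} (R : Carrier X → Pred (Carrier Y) p) →
    (∀ x → Satisfiable (R x)) →
    (∀ {x x′} → Setoid._≈_ X x x′ → R x ⊆ R x′) →
    (∀ {x x′ y y′} → y ∈ R x → y′ ∈ R x′ → Setoid._≈_ Y y y′ → Setoid._≈_ X x x′) →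
    X ≤ᶜ Y
  choose-injection {X = X} {Y = Y} R R-sat R-cong R-inj = record
    { to = λ x → c (R x) (R-sat x)
    ; cong = λ e → Setoid.reflexive Y (c-ext _ _ _ _ (R-cong e , R-cong (Setoid.sym X e)))
    ; injective = R-inj (c∈ (R _) (R-sat _)) (c∈ (R _) (R-sat _))
    }
    where
    c = proj₁ (ac (Carrier Y))
    c∈ = proj₁ (proj₂ (ac (Carrier Y)))
    c-ext = proj₂ (proj₂ (ac (Carrier Y)))

  module _ {T : Set t} (t₀ : T) where

    pick : Pred T p → T
    pick P with em {P = Satisfiable P}
    ... | yes s = proj₁ (ac T) P s
    ... | no _ = t₀

    pick∈ : (P : Pred T p) → Satisfiable P → pick P ∈ P
    pick∈ P s with em {P = Satisfiable P}
    ... | yes s = proj₁ (proj₂ (ac T)) P s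
    ... | no ∄ = contradiction s ∄

    pick-cong : {P P′ : Pred T p} → P ≐ P′ → pick P ≡ pick P′
    pick-cong {P = P} {P′} P≐P′ with em {P = Satisfiable P} | em {P = Satisfiable P′}
    ... | yes s | yes s′ = proj₂ (proj₂ (ac T)) P P′ s s′ P≐P′
    ... | yes (y , y∈P) | no ∄ = contradiction (y , proj₁ P≐P′ y∈P) ∄
    ... | no ∄ | yes (y , y∈P′) = contradiction (y , proj₂ P≐P′ y∈P′) ∄
    ... | no _ | no _ = refl

  module _ {D : Setoid d ℓ} (rank : D ≤ᶜ Ords) where
    open Ranked rank
    open Setoid D using (_≈_)

    -- Q x S is the set of admissible values at x when S is the set of values
    -- taken before x.  An extensional choice among them is what makes h
    -- respect the equality of D.
    transfinite-recursion : {T : Set t} → T →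
      (Q : Carrier D → Pred T (d ⊔ t) → Pred T p) →
      (∀ {x y S S′} → x ≈ y → S ≐ S′ → Q x S ⊆ Q y S′) →
      Σ[ h ∈ (Carrier D → T) ]
        (∀ {x y} → x ≈ y → h x ≡ h y) ×
        (∀ x → let S = image h (_◁ x) in Satisfiable (Q x S) → h x ∈ Q x S)
    transfinite-recursion {t = t} {T = T} t₀ Q Q-cong = h , h-cong , h∈Q
      where
      Q-ext : ∀ {x y S S′} → x ≈ y → S ≐ S′ → Q x S ≐ Q y S′
      Q-ext e (S⊆ , ⊆S) = Q-cong e (S⊆ , ⊆S) , Q-cong (Setoid.sym D e) (⊆S , S⊆)

      values : ∀ x → WF.WfRec _◁_ (λ _ → T) x → Pred T (d ⊔ t)
      values x IH y = ∃[ z ] Σ[ z◁x ∈ z ◁ x ] y ≡ IH z◁x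

      step : ∀ x → WF.WfRec _◁_ (λ _ → T) x → T
      step x IH = pick t₀ (Q x (values x IH))

      step-ext : ∀ x {IH IH′ : WF.WfRec _◁_ (λ _ → T) x} →
                 (∀ {y} y◁x → IH {y} y◁x ≡ IH′ y◁x) → step x IH ≡ step x IH′
      step-ext x eq = pick-cong t₀ (Q-ext (Setoid.refl D)
        ( (λ (z , z◁x , e) → z , z◁x , trans e (eq z◁x))
        , (λ (z , z◁x , e) → z , z◁x , trans e (sym (eq z◁x)))))

      h : Carrier D → T
      h = WF.All.wfRec ◁-wellFounded _ (λ _ → T) step

      unfold : ∀ x → h x ≡ pick t₀ (Q x (image h (_◁ x)))
      unfold x = WF.FixPoint.unfold-wfRec ◁-wellFounded (λ _ → T) step step-ext {x}

      h-cong : ∀ {x y} → x ≈ y → h x ≡ h y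
      h-cong {x} {y} e = trans (unfold x) (trans (pick-cong t₀ (Q-ext e before≐)) (sym (unfold y)))
        where
        before≐ : image h (_◁ x) ≐ image h (_◁ y)
        before≐ = (λ (z , z◁x , r) → z , <-≤-trans z◁x (proj₁ (rk-cong e)) , r)
                , (λ (z , z◁y , r) → z , <-≤-trans z◁y (proj₂ (rk-cong e)) , r)

      h∈Q : ∀ x → Satisfiable (Q x (image h (_◁ x))) → h x ∈ Q x (image h (_◁ x))
      h∈Q x s = subst (_∈ Q x (image h (_◁ x))) (sym (unfold x)) (pick∈ t₀ _ s)

    -- Send each x to an element of X that is not yet a value.  Either there always
    -- is one and D embeds into X, or the values before some x exhaust X.
    compare : (X : Setoid a p) → D ≤ᶜ X ⊎ ∃[ x ] X ≤ᶜ Segment x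
    compare X with em {P = Carrier X} | em {P = Carrier D}
    ... | no ∄y | yes x = inj₂ (x , choose-injection (λ _ _ → ⊥) (⊥-elim ∘ ∄y) (λ _ ()) λ ())
    ... | no ∄y | no ∄x = inj₁ (choose-injection (λ _ _ → ⊥) (⊥-elim ∘ ∄x) (λ _ ()) λ ())
    ... | yes y₀ | _ = go
      where
      open Setoid X using () renaming (_≈_ to _≈₁_)
      module X = Setoid X
      Fresh : Carrier D → Pred (Carrier X) _ → Pred (Carrier X) _
      Fresh _ S y = ∀ {z} → z ∈ S → ¬ (y ≈₁ z)

      recursion = transfinite-recursion y₀ Fresh λ _ (_ , S′⊆S) fresh z∈ → fresh (S′⊆S z∈)
      h = proj₁ recursion
      h-cong = proj₁ (proj₂ recursion)
      h-fresh = proj₂ (proj₂ recursion)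

      go : D ≤ᶜ X ⊎ ∃[ x ] X ≤ᶜ Segment x
      go with em {P = ∃[ x ] ¬ Satisfiable (Fresh x (image h (_◁ x)))}
      ... | yes (x , ∄) = inj₂ (x , choose-injection
              (λ y (z , _) → y ≈₁ h z)
              (λ y → by-contradiction λ ∄z → ∄ (y , λ { (z , z◁x , refl) y≈ → ∄z ((z , z◁x) , y≈) }))
              (λ y≈y′ y≈ → X.trans (X.sym y≈y′) y≈)
              (λ y≈ y′≈ z≈z′ → X.trans y≈ (X.trans (X.reflexive (h-cong z≈z′)) (X.sym y′≈))))
      ... | no ∄ = inj₁ (record { to = h ; cong = X.reflexive ∘ h-cong ; injective = h-injective })
        where
        fresh : ∀ x → h x ∈ Fresh x (image h (_◁ x))
        fresh x = h-fresh x (by-contradiction λ ¬s → ∄ (x , ¬s))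
        h-injective : ∀ {x y} → h x ≈₁ h y → x ≈ y
        h-injective {x} {y} hx≈hy with ≤-total (rk x) (rk y) | ≤-total (rk y) (rk x)
        ... | inj₂ y◁x | _ = contradiction hx≈hy (fresh x (y , y◁x , refl))
        ... | inj₁ _ | inj₂ x◁y = contradiction (X.sym hx≈hy) (fresh y (x , x◁y , refl))
        ... | inj₁ x⊴y | inj₁ y⊴x = rk-injective (x⊴y , y⊴x)

  -- The well-ordering theorem: Ord is too long to embed into X, so X is
  -- exhausted by a proper segment of Ord.
  embeds-Below : (X : Cardinal) → ∃[ α ] X ≤ᶜ Below α
  embeds-Below X = [ (λ h → contradiction h (burali-forti X)) , id ]′ (compare ≤ᶜ-refl X)

  -- The least element of C is the one that embeds below the least possible α:
  -- any ν in C either contains a copy of all of Below α or embeds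
  -- below a smaller ordinal.
  least-cardinal : {C : Pred Cardinal ℓ} → Satisfiable C → ∃ (IsLeast C)
  least-cardinal {C = C} (κ , κ∈C)
    with α , (μ , μ∈C , μ≤α) , <α∉ ← minimal {P = λ α → ∃[ μ ] μ ∈ C × μ ≤ᶜ Below α}
           (let (α , κ≤α) = embeds-Below κ in α , κ , κ∈C , κ≤α)
    = μ , μ∈C , λ ν ν∈C →
      [ μ≤α ⨾_
      , (λ ((β , β<α) , ν≤) → ⊥-elim (<α∉ β<α (ν , ν∈C , ν≤ ⨾ Segment≤Below (Below⊆ α) (β , β<α))))
      ]′ (compare (Below⊆ α) ν)

  min-isLeast : {C : Pred Cardinal ℓ} → Satisfiable C → IsLeast C (min em C)
  min-isLeast {C = C} s with em {P = ∃ (IsLeast C)}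
  ... | yes (_ , isLeast) = isLeast
  ... | no ∄ = contradiction (least-cardinal s) ∄

  opaque
    -- Rank X by an embedding below the least possible α, the initial ordinal of
    -- X.  The segments then embed below smaller ordinals, where X does not.
    initial-rank : (X : Cardinal) → Σ[ rank ∈ X ≤ᶜ Ords ] ∀ x → ¬ (X ≤ᶜ Ranked.Segment rank x)
    initial-rank X with α , X≤α , <α∉ ← minimal {P = λ α → X ≤ᶜ Below α} (embeds-Below X)
      = X≤α ⨾ Below⊆ α , λ x X≤ →
        <α∉ (proj₂ (Injection.to X≤α x)) (X≤ ⨾ Segment≤Below (X≤α ⨾ Below⊆ α) x)

  cantor : (X : Cardinal) → Satisfiable (X <ᶜ_)
  cantor X = 𝒫X , singleton , no-injection
    where
    open Setoid X using (_≈_)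
    module X = Setoid X
    𝒫X : Cardinal
    𝒫X = Carrier X →-setoid Bool

    singleton : X ≤ᶜ 𝒫X
    singleton = record
      { to = λ x y → truth (x ≈ y)
      ; cong = λ x≈x′ y → does-⇔ (mk⇔ (X.trans (X.sym x≈x′)) (X.trans x≈x′)) em em
      ; injective = λ {x} {x′} eq → true-truth (trans (eq x′) (truth-true X.refl))
      }

    -- The diagonal set consists of those x that code a set not containing x.
    no-injection : ¬ (𝒫X ≤ᶜ X)
    no-injection g = excluded (Δ (to Δ)) refl
      where
      open Injection g using (to; injective)

      Δ : Carrier X → Bool
      Δ x = truth (∃[ Q ] to Q ≈ x × Q x ≡ false)

      excluded : ∀ b → Δ (to Δ) ≡ b → ⊥
      excluded true eq with Q , e , r ← true-truth eq
        with () ← trans (sym eq) (trans (sym (injective e (to Δ))) r)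
      excluded false eq with () ← trans (sym eq) (truth-true (Δ , X.refl , eq))

  -- Ultrafilters and their dual ideals

  module _ {𝒰 : Family} where

    ∁∈⇒∈* : ∀ {B} → ∁ B ∈ 𝒰 → B ∈ 𝒰 *
    ∁∈⇒∈* {B} ∁B∈ = ∁ B , ∁B∈ , (λ n∈B n∉B → n∉B n∈B) , by-contradiction

    module _ (𝒰-ultra : IsUltrafilter 𝒰) where
      open IsUltrafilter 𝒰-ultra

      ∈*⇒∁∈ : ∀ {B} → B ∈ 𝒰 * → ∁ B ∈ 𝒰
      ∈*⇒∁∈ (A , A∈ , B⊆ , _) = ⊇-closed (λ n∈A n∈B → B⊆ n∈B n∈A) A∈

      *-isIdeal : IsIdeal (𝒰 *)
      *-isIdeal = record
        { ∪-closed = λ A∈ B∈ → ∁∈⇒∈* (⊇-closed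
            (λ { (n∉A , n∉B) → [ n∉A , n∉B ]′ }) (∩-closed (∈*⇒∁∈ A∈) (∈*⇒∁∈ B∈)))
        ; ⊆-closed = λ A⊆B B∈ → ∁∈⇒∈* (⊇-closed (λ n∉B n∈A → n∉B (A⊆B n∈A)) (∈*⇒∁∈ B∈))
        ; finite∈ = λ (xs , A⊆xs) → ∁∈⇒∈* (cofinite∈ (xs , A⊆xs ∘ by-contradiction))
        ; ω∉ = λ U∈ → ∅∉ (⊇-closed (λ n∉U → n∉U tt) (∈*⇒∁∈ U∈))
        }

  ∁-exclusive : ∀ {K B} → IsIdeal K → B ∈ K → ∁ B ∉ K
  ∁-exclusive {B = B} K-ideal B∈ ∁B∈ = ω∉ (⊆-closed (λ {n} _ → cover n) (∪-closed B∈ ∁B∈))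
    where
    open IsIdeal K-ideal
    cover : ∀ n → n ∈ B ∪ ∁ B
    cover n with em {P = n ∈ B}
    ... | yes n∈B = inj₁ n∈B
    ... | no n∉B = inj₂ n∉B

  -- A set outside of 𝒰 * lies in 𝒰, so its complement is already in 𝒰 * and a
  -- proper ideal above 𝒰 * cannot contain it.
  *-maximal : ∀ {𝒰 𝒜} → IsUltrafilter 𝒰 → U ∉ (𝒰 *) ⟨ 𝒜 ⟩ → (𝒰 *) ⟨ 𝒜 ⟩ ⊆ 𝒰 *
  *-maximal {𝒰} 𝒰-ultra U∉ {B} B∈ with IsUltrafilter.ultra 𝒰-ultra B
  ... | inj₂ ∁B∈𝒰 = ∁∈⇒∈* ∁B∈𝒰
  ... | inj₁ B∈𝒰 = contradiction
        (⊆⟨⟩ *-ideal (B , B∈𝒰 , id , id))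
        (∁-exclusive (⟨⟩-isIdeal *-ideal U∉) B∈)
    where *-ideal = *-isIdeal 𝒰-ultra

  -- Extending ideals by transfinite recursion

  module _ {K : Family} (K-ideal : IsIdeal K) {D : Cardinal} (rank : D ≤ᶜ Ords) where
    open Ranked rank
    open Setoid D using (_≈_)
    open IsIdeal K-ideal

    opaque
      -- A choice is admissible when it keeps the ideal generated so far proper.
      -- Finitely many choices are all made up to the last index x among
      -- them, so if they covered ω modulo K, then the choice at x would not
      -- have been admissible.
      greedy-extension : (Opt : Carrier D → Pred Subset p) →
        (∀ {x y} → x ≈ y → Opt x ⊆ Opt y) →
        (∀ h → (∀ {x y} → x ≈ y → h x ≡ h y) → ∀ x → let 𝒜 = image h (_◁ x) in
          U ∉ K ⟨ 𝒜 ⟩ → ∃[ A ] A ∈ Opt x × U ∉ K ⟨ 𝒜 ∪ ｛ A ｝ ⟩) →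
        Σ[ h ∈ (Carrier D → Subset) ] (∀ x → h x ∈ Opt x) × U ∉ K ⟨ image h U ⟩
      greedy-extension {p = p} Opt Opt-cong extend =
        h , (λ x → proj₁ (admissible x)) , proper (λ x _ → admissible x)
        where
        Admissible : Carrier D → Family → Pred Subset (p ⊔ 1ℓ)
        Admissible x 𝒜 A = A ∈ Opt x × U ∉ K ⟨ 𝒜 ∪ ｛ A ｝ ⟩

        recursion : Σ[ h ∈ (Carrier D → Subset) ]
          (∀ {x y} → x ≈ y → h x ≡ h y) ×
          (∀ x → let 𝒜 = image h (_◁ x) in Satisfiable (Admissible x 𝒜) → h x ∈ Admissible x 𝒜)
        recursion = transfinite-recursion rank ∅ Admissible
          λ x≈y (_ , 𝒜′⊆𝒜) (A∈ , U∉) → Opt-cong x≈y A∈ , U∉ ∘ ⟨⟩-mono {K} [ inj₁ ∘ 𝒜′⊆𝒜 , inj₂ ]′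

        h : Carrier D → Subset
        h = proj₁ recursion

        h-cong : ∀ {x y} → x ≈ y → h x ≡ h y
        h-cong = proj₁ (proj₂ recursion)

        last : ∀ {L : Pred (Carrier D) 0ℓ} {Fs} → All (_∈ image h L) Fs →
               Fs ≡ [] ⊎ ∃[ x ] x ∈ L × All (_∈ image h (_⊴ x)) Fs
        last [] = inj₁ refl
        last ((x , x∈L , e) ∷ Fs∈) with last Fs∈
        ... | inj₁ refl = inj₂ (x , x∈L , (x , ≤-refl , e) ∷ [])
        ... | inj₂ (y , y∈L , Fs∈′) with ≤-total (rk x) (rk y)
        ...   | inj₁ x⊴y = inj₂ (y , y∈L , (x , x⊴y , e) ∷ Fs∈′)
        ...   | inj₂ y◁x = inj₂ (x , x∈L , (x , ≤-refl , e) ∷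
                  All.map (λ (z , z⊴y , r) → z , ≤-trans z⊴y (<⇒≤ y◁x) , r) Fs∈′)

        ⊴⊆◁∪ : ∀ x → image h (_⊴ x) ⊆ image h (_◁ x) ∪ ｛ h x ｝
        ⊴⊆◁∪ x (y , y⊴x , refl) with ≤-total (rk x) (rk y)
        ... | inj₁ x⊴y = inj₂ (h-cong (rk-injective (x⊴y , y⊴x)))
        ... | inj₂ y◁x = inj₁ (y , y◁x , refl)

        proper : ∀ {L : Pred (Carrier D) 0ℓ} →
                 (∀ x → x ∈ L → h x ∈ Admissible x (image h (_◁ x))) → U ∉ K ⟨ image h L ⟩
        proper adm (Fs , Fs∈ , r) with last Fs∈
        ... | inj₁ refl = ω∉ (⊆-closed (λ _ → tt , λ ()) r)
        ... | inj₂ (x , x∈L , Fs∈′) = proj₂ (adm x x∈L) (Fs , All.map (⊴⊆◁∪ x) Fs∈′ , r)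

        admissible : ∀ x → h x ∈ Admissible x (image h (_◁ x))
        admissible = WF.All.wfRec ◁-wellFounded _ _ λ x IH →
          proj₂ (proj₂ recursion) x (extend h h-cong x (proper λ y y◁x → IH y◁x))

  -- Decide one subset of ω after the other, putting it or its complement into
  -- the ideal.  The complement can be added when the set itself is not in the
  -- ideal generated so far.  Otherwise the complement is not in that ideal, so
  -- the set can be kept.
  ultrafilter-extension : ∀ {K} → IsIdeal K → ∃[ 𝒰 ] IsUltrafilter 𝒰 × K ⊆ 𝒰 *
  ultrafilter-extension {K} K-ideal = 𝒰 , 𝒰-ultra , λ {B} B∈K →
      ∁∈⇒∈* {𝒰} (M.⊆-closed by-contradiction (⊆⟨⟩ K-ideal B∈K))
    where
    ⟦_⟧ : (ℕ → Bool) → Subset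
    ⟦ c ⟧ n = c n ≡ true

    -- Asking for an inclusion only is enough, as ideals are closed under subsets.
    Decides : (ℕ → Bool) → Pred Subset 0ℓ
    Decides c A = ⟦ c ⟧ ⊆ A ⊎ ∁ ⟦ c ⟧ ⊆ A

    Decides-cong : ∀ {c c′} → c ≗ c′ → Decides c ⊆ Decides c′
    Decides-cong c≗c′ (inj₁ c⊆A) = inj₁ λ {n} n∈ → c⊆A (trans (c≗c′ n) n∈)
    Decides-cong c≗c′ (inj₂ ∁c⊆A) = inj₂ λ {n} n∉ → ∁c⊆A λ n∈ → n∉ (trans (sym (c≗c′ n)) n∈)

    decide : ∀ {𝒜} c → U ∉ K ⟨ 𝒜 ⟩ → ∃[ A ] A ∈ Decides c × U ∉ K ⟨ 𝒜 ∪ ｛ A ｝ ⟩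
    decide {𝒜} c U∉ with em {P = ⟦ c ⟧ ∈ K ⟨ 𝒜 ⟩}
    ... | no c∉ = ∁ ⟦ c ⟧ , inj₂ id , ∉⇒∁-adjoinable K-ideal c∉
    ... | yes c∈ = ∁ (∁ ⟦ c ⟧) , inj₁ (λ n∈ n∉ → n∉ n∈) ,
                   ∉⇒∁-adjoinable K-ideal (∁-exclusive (⟨⟩-isIdeal K-ideal U∉) c∈)

    greedy : Σ[ h ∈ ((ℕ → Bool) → Subset) ] (∀ c → h c ∈ Decides c) × U ∉ K ⟨ image h U ⟩
    greedy = greedy-extension K-ideal (proj₁ (initial-rank 𝔠)) Decides Decides-cong λ _ _ c → decide c

    h : (ℕ → Bool) → Subset
    h = proj₁ greedy

    M : Family
    M = K ⟨ image h U ⟩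

    M-isIdeal : IsIdeal M
    M-isIdeal = ⟨⟩-isIdeal K-ideal (proj₂ (proj₂ greedy))
    module M = IsIdeal M-isIdeal

    h∈M : ∀ c → h c ∈ M
    h∈M c = generators∈⟨⟩ K-ideal (c , tt , refl)

    𝒰 : Family
    𝒰 B = ∁ B ∈ M

    decided : ∀ B → B ∈ 𝒰 ⊎ ∁ B ∈ 𝒰
    decided B with proj₁ (proj₂ greedy) (λ n → truth (n ∈ B))
    ... | inj₁ B⊆ = inj₂ (M.⊆-closed (λ n∈ → B⊆ (truth-true (by-contradiction n∈))) (h∈M _))
    ... | inj₂ ∁B⊆ = inj₁ (M.⊆-closed (λ n∉ → ∁B⊆ (n∉ ∘ true-truth)) (h∈M _))

    𝒰-ultra : IsUltrafilter 𝒰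
    𝒰-ultra = record
      { ∩-closed = λ {A} {B} A∈ B∈ → M.⊆-closed {B = ∁ A ∪ ∁ B} (deMorgan A B) (M.∪-closed A∈ B∈)
      ; ⊇-closed = λ A⊆B → M.⊆-closed (λ n∉B n∈A → n∉B (A⊆B n∈A))
      ; cofinite∈ = M.finite∈
      ; ∅∉ = λ ∁∅∈ → M.ω∉ (M.⊆-closed (λ _ ()) ∁∅∈)
      ; ultra = decided
      }
      where
      deMorgan : ∀ A B → ∁ (A ∩ B) ⊆ ∁ A ∪ ∁ B
      deMorgan A B {n} n∉ with em {P = n ∈ A}
      ... | yes n∈A = inj₂ λ n∈B → n∉ (n∈A , n∈B)
      ... | no n∉A = inj₁ n∉A

  -- Defeating all functions of a family

  image-≤ᶜ : {D : Cardinal} {h : Carrier D → Subset} (L : Pred (Carrier D) 0ℓ) →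
             (∀ {x y} → Setoid._≈_ D x y → h x ≡ h y) →
             cardFamily (image h L) ≤ᶜ Subsetoid D L
  image-≤ᶜ {h = h} L h-cong = choose-injection (λ (A , _) (x , _) → A ≐ h x)
    (λ { (A , x , x∈L , refl) → (x , x∈L) , id , id })
    (λ (A⊆ , ⊆A) (A⊆h , h⊆A) → A⊆h ∘ ⊆A , A⊆ ∘ h⊆A)
    λ {(A , _)} {(A′ , _)} (A⊆h , h⊆A) (A′⊆h , h⊆A′) x≈y →
      (λ n∈ → h⊆A′ (subst (_ ∈_) (h-cong x≈y) (A⊆h n∈))) ,
      (λ n∈ → h⊆A (subst (_ ∈_) (sym (h-cong x≈y)) (A′⊆h n∈)))

  -- Going through F in its initial order, fewer than |F| sets have been added
  -- when f is reached, so there is a B in I with f ⊢ B outside of the ideal, and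
  -- ∁ (f ⊢ B) can be added to it.
  defeating-ultrafilter : ∀ {I J′ F} → IsIdeal J′ →
    (∀ 𝒜 → cardFamily 𝒜 <ᶜ card F → U ∉ J′ ⟨ 𝒜 ⟩ → ¬ (I ≤[ F ] J′ ⟨ 𝒜 ⟩)) →
    ∃[ 𝒰 ] IsUltrafilter 𝒰 × ¬ (I ≤[ F ] 𝒰 *) × J′ ⊆ 𝒰 *
  defeating-ultrafilter {I} {J′} {F} J′-ideal defeated =
    let (𝒰 , 𝒰-ultra , K⊆𝒰*) = ultrafilter-extension K-ideal in
    𝒰 , 𝒰-ultra ,
    (λ (f , f∈F , I≤) →
      let (B , B∈I , ∁⊆) = proj₁ (proj₂ greedy) (f , f∈F)
          ∁∈K = IsIdeal.⊆-closed K-ideal ∁⊆ (generators∈⟨⟩ J′-ideal (_ , tt , refl))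
      in ∁-exclusive (*-isIdeal 𝒰-ultra) (I≤ B B∈I) (K⊆𝒰* ∁∈K)) ,
    K⊆𝒰* ∘ ⊆⟨⟩ J′-ideal
    where
    rank = proj₁ (initial-rank (card F))
    open Ranked rank

    Defeats : ∃ F → Family
    Defeats (f , _) A = ∃[ B ] B ∈ I × ∁ (f ⊢ B) ⊆ A

    Defeats-cong : ∀ {f g} → proj₁ f ≗ proj₁ g → Defeats f ⊆ Defeats g
    Defeats-cong f≗g (B , B∈I , ∁⊆) =
      B , B∈I , λ {n} gn∉B → ∁⊆ λ fn∈B → gn∉B (subst (_∈ B) (f≗g n) fn∈B)

    defeat : ∀ h → (∀ {f g} → proj₁ f ≗ proj₁ g → h f ≡ h g) → ∀ f → let 𝒜 = image h (_◁ f) in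
             U ∉ J′ ⟨ 𝒜 ⟩ → ∃[ A ] A ∈ Defeats f × U ∉ J′ ⟨ 𝒜 ∪ ｛ A ｝ ⟩
    defeat h h-cong f@(f₀ , f∈F) U∉ = by-contradiction λ ∄ →
      defeated _ small U∉ (f₀ , f∈F , λ B B∈I → by-contradiction λ ∉ →
        ∄ (∁ (f₀ ⊢ B) , (B , B∈I , λ {_} n∉ → n∉) , ∉⇒∁-adjoinable J′-ideal ∉))
      where
      𝒜≤Segment : cardFamily (image h (_◁ f)) ≤ᶜ Segment f
      𝒜≤Segment = image-≤ᶜ (_◁ f) h-cong

      small : cardFamily (image h (_◁ f)) <ᶜ card F
      small = 𝒜≤Segment ⨾ Segment⊆ f
            , λ F≤𝒜 → proj₂ (initial-rank (card F)) f (F≤𝒜 ⨾ 𝒜≤Segment)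

    greedy = greedy-extension J′-ideal rank Defeats (λ {f} {g} → Defeats-cong {f} {g}) defeat
    K-ideal = ⟨⟩-isIdeal J′-ideal (proj₂ (proj₂ greedy))

theorem3p4 : (em : ∀ {ℓ} → ExcludedMiddle ℓ) →
    (ac : ∀ {a p} → AxiomOfChoice a p) →
    (I J : Family) → IsIdeal I → IsIdeal J →
    (F G : Functions) → id ∈ G →
    (card F <ᶜ 𝔲 em I F J G) ⇔ (∃[ 𝒰 ] IsUltrafilter 𝒰 × ¬ (I ≤[ F ] 𝒰 *) × J ≤[ G ] 𝒰 *)
theorem3p4 em ac I J _ _ F G _ = mk⇔ ultrafilter large
  where
  open ZFC em ac

  𝔲-isLeast : IsLeast _ (𝔲 em I F J G)
  𝔲-isLeast = min-isLeast (𝔠⁺ em , inj₂ (Identity.bijection _))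

  ultrafilter : card F <ᶜ 𝔲 em I F J G → ∃[ 𝒰 ] IsUltrafilter 𝒰 × ¬ (I ≤[ F ] 𝒰 *) × J ≤[ G ] 𝒰 *
  ultrafilter (_ , 𝔲≰F) = by-contradiction λ ∄𝒰 →
    𝔲≰F (proj₂ 𝔲-isLeast (card F) (inj₁ (card≤𝔠 F , λ J′ J′-ideal (g , g∈G , J≤) →
      by-contradiction λ ∄𝒜 →
        let (𝒰 , 𝒰-ultra , I≰ , J′⊆) = defeating-ultrafilter {F = F} J′-ideal
              (λ 𝒜 𝒜<F U∉ I≤ → ∄𝒜 (𝒜 , 𝒜<F , U∉ , I≤))
        in ∄𝒰 (𝒰 , 𝒰-ultra , I≰ , g , g∈G , λ B B∈J → J′⊆ (J≤ B B∈J)))))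

  large : (∃[ 𝒰 ] IsUltrafilter 𝒰 × ¬ (I ≤[ F ] 𝒰 *) × J ≤[ G ] 𝒰 *) → card F <ᶜ 𝔲 em I F J G
  large (𝒰 , 𝒰-ultra , I≰ , J≤) with proj₁ 𝔲-isLeast
  -- 𝒰 * is maximal, so adding sets to it cannot help.
  ... | inj₁ (_ , I≼J) =
    let (𝒜 , _ , U∉ , f , f∈F , I≤) = I≼J (𝒰 *) (*-isIdeal 𝒰-ultra) J≤
    in contradiction (f , f∈F , λ B B∈I → *-maximal 𝒰-ultra U∉ (I≤ B B∈I)) I≰
  ... | inj₂ 𝔲≈𝔠⁺ = card≤𝔠 F ⨾ 𝔠≤𝔠⁺ ⨾ Inverse⇒Injection (Inverse.sym 𝔲↔𝔠⁺)
                  , λ 𝔲≤F → 𝔠⁺≰𝔠 (Inverse⇒Injection (Inverse.sym 𝔲↔𝔠⁺) ⨾ 𝔲≤F ⨾ card≤𝔠 F)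
    where
    𝔲↔𝔠⁺ = Bijection⇒Inverse 𝔲≈𝔠⁺
    𝔠<𝔠⁺ : 𝔠 <ᶜ 𝔠⁺ em
    𝔠<𝔠⁺ = proj₁ (min-isLeast (cantor 𝔠))
    𝔠≤𝔠⁺ = proj₁ 𝔠<𝔠⁺
    𝔠⁺≰𝔠 = proj₂ 𝔠<𝔠⁺
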